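{- For every triple $a,b,c$ of integers with $2\leq a\leq b\leq c$, there exists a connected graph $G$ such that $spvc(G)=a$, $\chi(G)=b$ and $\Delta(G)=c$.
   Context: All graphs are simple, finite and undirected. $\chi(G)$ is the chromatic number and $\Delta(G)$ the maximum degree of $G$. In the following definitions, vertex-colorings are arbitrary (adjacent vertices may receive the same color). A path in a vertex-colored graph is a vertex-proper path if any two adjacent internal vertices of the path differ in color (the end-vertices are not internal). A $u$-$v$ geodesic is a $u$-$v$ path of length $d(u,v)$. A vertex-colored graph is strong proper vertex-connected if for any two distinct vertices $u,v$ there exists a vertex-proper $u$-$v$ geodesic. For a connected graph $G$, $spvc(G)$ is the smallest number of colors required to make $G$ strong proper vertex-connected. -}

module Defs where

open import Data.Fin.Base using (Fin)
open import Data.Fin.Subset using (Subset; ∣_∣)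
open import Data.List.Base using (List; []; _∷_)
open import Data.List.Relation.Unary.Linked using (Linked)
open import Data.List.Relation.Unary.Unique.Propositional using (Unique)
open import Data.Nat.Base using (ℕ; suc; _≤_)
open import Data.Product.Base using (∃; Σ-syntax; _×_; _,_)
open import Data.Vec.Base using (tabulate)
open import Function.Base using (_on_)
open import Level using (0ℓ)
open import Relation.Binary.Construct.Closure.ReflexiveTransitive
  using (Star; ε; _◅_; fold)
open import Relation.Binary.Core using (Rel)
open import Relation.Binary.Definitions using (Decidable; Irreflexive; Symmetric)
open import Relation.Binary.PropositionalEquality.Core using (_≡_; _≢_)
open import Relation.Nullary.Decidable.Core using (does)

Least : (ℕ → Set) → ℕ → Set
Least P n = P n × (∀ m → P m → n ≤ m)

Greatest : (ℕ → Set) → ℕ → Set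
Greatest P n = P n × (∀ m → P m → m ≤ n)

record Graph : Set₁ where
  infix 4 _~_ _~?_
  field
    order    : ℕ
    _~_      : Rel (Fin order) 0ℓ
    _~?_     : Decidable _~_
    ~-sym    : Symmetric _~_
    ~-irrefl : Irreflexive _≡_ _~_

  Vertex : Set
  Vertex = Fin order

  Walk : Rel Vertex 0ℓ
  Walk = Star _~_

  vertices : ∀ {u v} → Walk u v → List Vertex
  vertices {u} ε       = u ∷ []
  vertices {u} (_ ◅ w) = u ∷ vertices w

  -- The vertices of a walk, in order, without its two ends.
  internal : ∀ {u v} → Walk u v → List Vertex
  internal ε                       = []
  internal (_ ◅ ε)                 = []
  internal (_◅_ {j = x} _ (e ◅ w)) = x ∷ internal (e ◅ w)

  length : ∀ {u v} → Walk u v → ℕ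
  length = fold (λ _ _ → ℕ) (λ _ → suc) 0

  Path : Rel Vertex 0ℓ
  Path u v = Σ[ w ∈ Walk u v ] Unique (vertices w)

  pathLength : ∀ {u v} → Path u v → ℕ
  pathLength (w , _) = length w

  Connected : Set
  Connected = ∀ u v → Path u v

  -- d(u,v) = n.
  Distance : Vertex → Vertex → ℕ → Set
  Distance u v = Least (λ n → Σ[ p ∈ Path u v ] pathLength p ≡ n)

  IsGeodesic : ∀ {u v} → Path u v → Set
  IsGeodesic {u} {v} p = Distance u v (pathLength p)

  neighbours : Vertex → Subset order
  neighbours v = tabulate (λ w → does (v ~? w))

  degree : Vertex → ℕ
  degree v = ∣ neighbours v ∣

  -- Colourings with at most k colours; adjacent vertices may share a colour.
  Colouring : ℕ → Set
  Colouring k = Vertex → Fin k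

  ProperColouring : ∀ {k} → Colouring k → Set
  ProperColouring c = ∀ {u v} → u ~ v → c u ≢ c v

  VertexProper : ∀ {k} → Colouring k → ∀ {u v} → Path u v → Set
  VertexProper c (w , _) = Linked (_≢_ on c) (internal w)

  StrongProperVertexConnected : ∀ {k} → Colouring k → Set
  StrongProperVertexConnected c =
    ∀ u v → u ≢ v → Σ[ p ∈ Path u v ] (IsGeodesic p × VertexProper c p)

-- The invariants are stated as relations: the value of the invariant of G is n.

ChromaticNumber : Graph → ℕ → Set
ChromaticNumber G = Least (λ k → Σ[ c ∈ Colouring k ] ProperColouring c)
  where open Graph G

MaximumDegree : Graph → ℕ → Set
MaximumDegree G = Greatest (λ d → ∃ λ v → degree v ≡ d)
  where open Graph G

Spvc : Graph → ℕ → Set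
Spvc G = Least (λ k → Σ[ c ∈ Colouring k ] StrongProperVertexConnected c)
  where open Graph G

{-# OPTIONS --safe #-}
-- Take the clique K_b and hang pendant vertices on it: c ∸ b + 1 on one clique
-- vertex and one on each of a ∸ 1 others.  If p and q are pendants at distinct
-- clique vertices x and y, then the only p-q geodesic is p, x, y, q.  So a
-- colouring is strong proper only if the a clique vertices carrying pendants have
-- distinct colours, and this suffices because every other geodesic has at most one
-- internal vertex.
module Submission where

open import Defs
open import Data.Bool.Base using (Bool; true; false; not)
open import Data.Empty using (⊥; ⊥-elim)
open import Data.Fin.Base using (Fin; zero; suc; _↑ˡ_; _↑ʳ_; splitAt; join; punchIn)
open import Data.Fin.Properties
  using (_≟_; splitAt-join; join-splitAt; splitAt-↑ˡ; splitAt-↑ʳ; ↑ˡ-injective;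
         injective⇒≤; punchInᵢ≢i)
open import Data.Fin.Subset using (∣_∣)
open import Data.Fin.Subset.Properties using (∣∁p∣≡n∸∣p∣; ∣p∣≤n)
open import Data.List.Relation.Unary.All using ([]; _∷_)
open import Data.List.Relation.Unary.AllPairs using ([]; _∷_)
open import Data.List.Relation.Unary.Linked using (Linked; []; [-]; _∷_)
open import Data.Nat.Base using (ℕ; zero; suc; _+_; _∸_; _≤_; z≤n; s≤s)
open import Data.Nat.Properties
  using (+-comm; +-suc; +-monoʳ-≤; +-mono-≤; m≤m+n; ≤-reflexive; ≤-antisym;
         m≤n⇒∃[o]m+o≡n; module ≤-Reasoning)
open import Data.Product.Base using (Σ-syntax; _×_; _,_; proj₁)
open import Data.Sum.Base using (_⊎_; inj₁; inj₂; [_,_]′)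
open import Data.Sum.Properties using (inj₁-injective; inj₂-injective)
open import Data.Vec.Base using (tabulate)
open import Data.Vec.Properties using (tabulate-cong; tabulate-∘)
open import Function.Base using (_∘_; _on_; id; const)
open import Relation.Binary.Construct.Closure.ReflexiveTransitive using (ε; _◅_)
open import Relation.Binary.PropositionalEquality
open import Relation.Nullary using (¬_; Dec; yes; no; does)
open import Relation.Nullary.Decidable using (¬?)

-- Sizes of subsets given by Boolean functions

∣tabulate∣-cong : ∀ {n} {f g : Fin n → Bool} → f ≗ g → ∣ tabulate f ∣ ≡ ∣ tabulate g ∣
∣tabulate∣-cong f≗g = cong ∣_∣ (tabulate-cong f≗g)

∣tabulate∣-+ : ∀ m {n} (f : Fin (m + n) → Bool) →
  ∣ tabulate f ∣ ≡ ∣ tabulate (f ∘ (_↑ˡ n)) ∣ + ∣ tabulate (f ∘ (m ↑ʳ_)) ∣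
∣tabulate∣-+ zero    f = refl
∣tabulate∣-+ (suc m) f with f zero
... | true  = cong suc (∣tabulate∣-+ m (f ∘ suc))
... | false = ∣tabulate∣-+ m (f ∘ suc)

∣tabulate-true∣ : ∀ n → ∣ tabulate {n = n} (const true) ∣ ≡ n
∣tabulate-true∣ zero    = refl
∣tabulate-true∣ (suc n) = cong suc (∣tabulate-true∣ n)

∣tabulate-false∣ : ∀ n → ∣ tabulate {n = n} (const false) ∣ ≡ 0
∣tabulate-false∣ zero    = refl
∣tabulate-false∣ (suc n) = ∣tabulate-false∣ n

∣tabulate-≟∣ : ∀ {n} (i : Fin n) → ∣ tabulate (λ j → does (i ≟ j)) ∣ ≡ 1
∣tabulate-≟∣ {suc n} zero    = cong suc (∣tabulate-false∣ n)
∣tabulate-≟∣ {suc n} (suc i) = ∣tabulate-≟∣ i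

∣tabulate-≢∣ : ∀ {n} (i : Fin n) → ∣ tabulate (λ j → not (does (i ≟ j))) ∣ ≡ n ∸ 1
∣tabulate-≢∣ {n} i = begin
  ∣ tabulate (λ j → not (does (i ≟ j))) ∣  ≡⟨ cong ∣_∣ (tabulate-∘ not (λ j → does (i ≟ j))) ⟩
  _                                        ≡⟨ ∣∁p∣≡n∸∣p∣ (tabulate (λ j → does (i ≟ j))) ⟩
  n ∸ ∣ tabulate (λ j → does (i ≟ j)) ∣    ≡⟨ cong (n ∸_) (∣tabulate-≟∣ i) ⟩
  n ∸ 1                                    ∎
  where open ≡-Reasoning

-- Geodesics of length at most three

module Geodesics (G : Graph) where
  open Graph G

  ~⇒≢ : ∀ {u v} → u ~ v → u ≢ v
  ~⇒≢ u~v u≡v = ~-irrefl u≡v u~v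

  Geodesic : ∀ {k} → Colouring k → Vertex → Vertex → Set
  Geodesic c u v = Σ[ p ∈ Path u v ] (IsGeodesic p × VertexProper c p)

  -- Every path is a walk, so a bound over all walks suffices; it can be proved by cases on the walk
  -- alone, without its `Unique` proof.
  shortest⇒geodesic : ∀ {u v} (p : Path u v) →
    ((w : Walk u v) → pathLength p ≤ length w) → IsGeodesic p
  shortest⇒geodesic p bound = (p , refl) , λ { m ((w , _) , refl) → bound w }

  geodesic₁ : ∀ {k} (c : Colouring k) {u v} → u ~ v → Geodesic c u v
  geodesic₁ c {u} {v} u~v = p , shortest⇒geodesic p bound , []
    where
    p : Path u v
    p = u~v ◅ ε , (~⇒≢ u~v ∷ []) ∷ [] ∷ []

    bound : (w : Walk u v) → 1 ≤ length w
    bound ε       = ⊥-elim (~-irrefl refl u~v)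
    bound (_ ◅ _) = s≤s z≤n

  geodesic₂ : ∀ {k} (c : Colouring k) {u x v} → u ≢ v → ¬ u ~ v →
    u ~ x → x ~ v → Geodesic c u v
  geodesic₂ c {u} {x} {v} u≢v u≁v u~x x~v = p , shortest⇒geodesic p bound , [-]
    where
    p : Path u v
    p = u~x ◅ x~v ◅ ε , (~⇒≢ u~x ∷ u≢v ∷ []) ∷ (~⇒≢ x~v ∷ []) ∷ [] ∷ []

    bound : (w : Walk u v) → 2 ≤ length w
    bound ε             = ⊥-elim (u≢v refl)
    bound (e ◅ ε)       = ⊥-elim (u≁v e)
    bound (_ ◅ _ ◅ _)   = s≤s (s≤s z≤n)

  module _ {u x y v} (u≢v : u ≢ v) (u≁v : ¬ u ~ v)
           (u~x : u ~ x) (x~y : x ~ y) (y~v : y ~ v)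
           (only-x : ∀ {z} → u ~ z → z ≡ x) (only-y : ∀ {z} → z ~ v → z ≡ y) where

    path₃ : Path u v
    path₃ = u~x ◅ x~y ◅ y~v ◅ ε ,
            (~⇒≢ u~x ∷ u≢y ∷ u≢v ∷ []) ∷ (~⇒≢ x~y ∷ x≢v ∷ []) ∷ (~⇒≢ y~v ∷ []) ∷ [] ∷ []
      where
      u≢y : u ≢ y
      u≢y refl = u≁v y~v

      x≢v : x ≢ v
      x≢v refl = u≁v u~x

    -- Such a `z` would equal both `x` and `y`, which are adjacent and hence distinct. This excludes
    -- walks of length two from `u` to `v`.
    noCommonNeighbour : ∀ {z} → u ~ z → ¬ z ~ v
    noCommonNeighbour u~z z~v = ~⇒≢ x~y (trans (sym (only-x u~z)) (only-y z~v))

    geodesic₃ : ∀ {k} (c : Colouring k) → c x ≢ c y → Geodesic c u v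
    geodesic₃ c cx≢cy = path₃ , shortest⇒geodesic path₃ bound , cx≢cy ∷ [-]
      where
      bound : (w : Walk u v) → 3 ≤ length w
      bound ε               = ⊥-elim (u≢v refl)
      bound (e ◅ ε)         = ⊥-elim (u≁v e)
      bound (e ◅ f ◅ ε)     = ⊥-elim (noCommonNeighbour e f)
      bound (_ ◅ _ ◅ _ ◅ _) = s≤s (s≤s (s≤s z≤n))

    -- A geodesic is at most as long as `path₃`, and shorter walks are impossible. So it has exactly
    -- three edges, and `only-x` and `only-y` force its two internal vertices to be `x` and `y`.
    geodesic₃-separates : ∀ {k} (c : Colouring k) → Geodesic c u v → c x ≢ c y
    geodesic₃-separates c ((w , _) , (_ , least) , proper) =
      separates w (least 3 (path₃ , refl)) proper
      where
      separates : (w : Walk u v) → length w ≤ 3 → Linked (_≢_ on c) (internal w) → c x ≢ c y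
      separates ε               _ _ = ⊥-elim (u≢v refl)
      separates (e ◅ ε)         _ _ = ⊥-elim (u≁v e)
      separates (e ◅ f ◅ ε)     _ _ = ⊥-elim (noCommonNeighbour e f)
      separates (e ◅ _ ◅ g ◅ ε) _ (ci≢cj ∷ _) =
        subst₂ (λ i j → c i ≢ c j) (only-x e) (only-y g) ci≢cj
      separates (_ ◅ _ ◅ _ ◅ _ ◅ _) (s≤s (s≤s (s≤s ()))) _

  stronglyProper⇒connected : ∀ {k} {c : Colouring k} →
    StrongProperVertexConnected c → Connected
  stronglyProper⇒connected strong u v with u ≟ v
  ... | yes refl = ε , [] ∷ []
  ... | no  u≢v  = proj₁ (strong u v u≢v)

-- A clique with pendant vertices attached along a map

module PendantClique {b n : ℕ} (h : Fin n → Fin b) where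

  -- The map `h` sends a pendant to the clique vertex that carries it. Adjacency is defined on the
  -- sum so that it computes by kind of vertex; `graph` transports it to `Fin (b + n)` through
  -- `splitAt`.
  Adjacent : Fin b ⊎ Fin n → Fin b ⊎ Fin n → Set
  Adjacent (inj₁ i) (inj₁ j) = i ≢ j
  Adjacent (inj₁ i) (inj₂ q) = i ≡ h q
  Adjacent (inj₂ p) (inj₁ j) = h p ≡ j
  Adjacent (inj₂ p) (inj₂ q) = ⊥

  adjacent? : ∀ s t → Dec (Adjacent s t)
  adjacent? (inj₁ i) (inj₁ j) = ¬? (i ≟ j)
  adjacent? (inj₁ i) (inj₂ q) = i ≟ h q
  adjacent? (inj₂ p) (inj₁ j) = h p ≟ j
  adjacent? (inj₂ p) (inj₂ q) = no id

  Adjacent-sym : ∀ s t → Adjacent s t → Adjacent t s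
  Adjacent-sym (inj₁ i) (inj₁ j) = ≢-sym
  Adjacent-sym (inj₁ i) (inj₂ q) = sym
  Adjacent-sym (inj₂ p) (inj₁ j) = sym
  Adjacent-sym (inj₂ p) (inj₂ q) = id

  Adjacent-irrefl : ∀ s → ¬ Adjacent s s
  Adjacent-irrefl (inj₁ i) i≢i = i≢i refl
  Adjacent-irrefl (inj₂ p) ()

  graph : Graph
  graph = record
    { order    = b + n
    ; _~_      = λ u v → Adjacent (splitAt b u) (splitAt b v)
    ; _~?_     = λ u v → adjacent? (splitAt b u) (splitAt b v)
    ; ~-sym    = λ {u} {v} → Adjacent-sym (splitAt b u) (splitAt b v)
    ; ~-irrefl = λ { {u} refl → Adjacent-irrefl (splitAt b u) }
    }

  open Graph graph
  open Geodesics graph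

  vertex : Fin b ⊎ Fin n → Vertex
  vertex = join b n

  core : Fin b → Vertex
  core = vertex ∘ inj₁

  pendant : Fin n → Vertex
  pendant = vertex ∘ inj₂

  split-vertex : ∀ s → splitAt b (vertex s) ≡ s
  split-vertex = splitAt-join b n

  ∀-vertex : {P : Vertex → Set} → (∀ s → P (vertex s)) → ∀ u → P u
  ∀-vertex {P} f u = subst P (join-splitAt b n u) (f (splitAt b u))

  adjacent⇒~ : ∀ s t → Adjacent s t → vertex s ~ vertex t
  adjacent⇒~ s t = subst₂ Adjacent (sym (split-vertex s)) (sym (split-vertex t))

  ~⇒adjacent : ∀ s t → vertex s ~ vertex t → Adjacent s t
  ~⇒adjacent s t = subst₂ Adjacent (split-vertex s) (split-vertex t)

  pendant~ : ∀ p {u} → pendant p ~ u → u ≡ core (h p)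
  pendant~ p {u} = ∀-vertex {λ u → pendant p ~ u → u ≡ core (h p)} cases u
    where
    cases : ∀ s → pendant p ~ vertex s → vertex s ≡ core (h p)
    cases (inj₁ i) e = cong core (sym (~⇒adjacent (inj₂ p) (inj₁ i) e))
    cases (inj₂ q) e = ⊥-elim (~⇒adjacent (inj₂ p) (inj₂ q) e)

  vertex-injective : ∀ {s t} → vertex s ≡ vertex t → s ≡ t
  vertex-injective {s} {t} eq =
    trans (sym (split-vertex s)) (trans (cong (splitAt b) eq) (split-vertex t))

  core-injective : ∀ {i j} → core i ≡ core j → i ≡ j
  core-injective = inj₁-injective ∘ vertex-injective

  core~core : ∀ {i j} → i ≢ j → core i ~ core j
  core~core {i} {j} = adjacent⇒~ (inj₁ i) (inj₁ j)

  core~pendant : ∀ p → core (h p) ~ pendant p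
  core~pendant p = adjacent⇒~ (inj₁ (h p)) (inj₂ p) refl

  pendant~core : ∀ p → pendant p ~ core (h p)
  pendant~core p = adjacent⇒~ (inj₂ p) (inj₁ (h p)) refl

  pendant≁pendant : ∀ p q → ¬ pendant p ~ pendant q
  pendant≁pendant p q = ~⇒adjacent (inj₂ p) (inj₂ q)

  ~pendant : ∀ q {u} → u ~ pendant q → u ≡ core (h q)
  ~pendant q {u} u~q = pendant~ q (~-sym {u} {pendant q} u~q)

  -- Colourings built as `κ ∘ root` give a pendant the colour of its clique vertex, which is
  -- harmless since a pendant is never internal to a path.
  root : Vertex → Fin b
  root = [ id , h ]′ ∘ splitAt b

  root-core : ∀ i → root (core i) ≡ i
  root-core i = cong [ id , h ]′ (split-vertex (inj₁ i))

  -- Distances are at most three, and only two pendants at distinct clique vertices reach three.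
  -- Their geodesic has the internal vertices `core (h p)` and `core (h q)`, which `κ` separates by
  -- hypothesis.
  root-stronglyProper : ∀ {k} (κ : Fin b → Fin k) →
    (∀ p q → h p ≢ h q → κ (h p) ≢ κ (h q)) → StrongProperVertexConnected (κ ∘ root)
  root-stronglyProper κ κ-sep u v = ∀-vertex
    {λ u → u ≢ v → Geodesic c u v}
    (λ s → ∀-vertex {λ v → vertex s ≢ v → Geodesic c (vertex s) v} (cases s) v) u
    where
    c = κ ∘ root

    cases : ∀ s t → vertex s ≢ vertex t → Geodesic c (vertex s) (vertex t)
    cases (inj₁ i) (inj₁ j) u≢v = geodesic₁ c (core~core (u≢v ∘ cong core))
    cases (inj₁ i) (inj₂ q) u≢v with i ≟ h q
    ... | yes refl = geodesic₁ c (core~pendant q)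
    ... | no  i≢hq = geodesic₂ c u≢v (i≢hq ∘ ~⇒adjacent (inj₁ i) (inj₂ q))
                       (core~core i≢hq) (core~pendant q)
    cases (inj₂ p) (inj₁ j) u≢v with h p ≟ j
    ... | yes refl = geodesic₁ c (pendant~core p)
    ... | no  hp≢j = geodesic₂ c u≢v (hp≢j ∘ ~⇒adjacent (inj₂ p) (inj₁ j))
                       (pendant~core p) (core~core hp≢j)
    cases (inj₂ p) (inj₂ q) u≢v with h p ≟ h q
    ... | yes hp≡hq = geodesic₂ c u≢v (pendant≁pendant p q) (pendant~core p)
                        (subst (λ i → core i ~ pendant q) (sym hp≡hq) (core~pendant q))
    ... | no  hp≢hq = geodesic₃ u≢v (pendant≁pendant p q)
                        (pendant~core p) (core~core hp≢hq) (core~pendant q)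
                        (pendant~ p) (~pendant q) c
                        (subst₂ (λ i j → κ i ≢ κ j) (sym (root-core (h p)))
                          (sym (root-core (h q))) (κ-sep p q hp≢hq))

  stronglyProper-separates : ∀ {k} (c : Colouring k) → StrongProperVertexConnected c →
    ∀ {p q} → h p ≢ h q → c (core (h p)) ≢ c (core (h q))
  stronglyProper-separates c strong {p} {q} hp≢hq =
    geodesic₃-separates p≢q (pendant≁pendant p q)
      (pendant~core p) (core~core hp≢hq) (core~pendant q) (pendant~ p) (~pendant q)
      c (strong (pendant p) (pendant q) p≢q)
    where
    p≢q : pendant p ≢ pendant q
    p≢q = hp≢hq ∘ cong h ∘ inj₂-injective ∘ vertex-injective

  connected : Connected
  -- For `κ = id` the separation condition is trivial, so `root` is strong proper and its geodesics
  -- connect the graph.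
  connected = stronglyProper⇒connected {c = root} (root-stronglyProper id (λ _ _ → id))

  -- A proper colouring is injective on the clique.
  proper⇒≤ : ∀ {k} (c : Colouring k) → ProperColouring c → b ≤ k
  proper⇒≤ c proper = injective⇒≤ {f = c ∘ core} injective
    where
    injective : ∀ {i j} → c (core i) ≡ c (core j) → i ≡ j
    injective {i} {j} ci≡cj with i ≟ j
    ... | yes i≡j = i≡j
    ... | no  i≢j = ⊥-elim (proper {core i} {core j} (core~core i≢j) ci≡cj)

  -- f i is a colour for the pendants at i.
  properColouring : (f : Fin b → Fin b) → (∀ i → i ≢ f i) →
    Σ[ c ∈ Colouring b ] ProperColouring c
  properColouring f i≢fi = colour ∘ splitAt b , λ {u} {v} → proper (splitAt b u) (splitAt b v)
    where
    colour : Fin b ⊎ Fin n → Fin b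
    colour = [ id , f ∘ h ]′

    proper : ∀ s t → Adjacent s t → colour s ≢ colour t
    proper (inj₁ i) (inj₁ j) i≢j  = i≢j
    proper (inj₁ _) (inj₂ q) refl = i≢fi (h q)
    proper (inj₂ p) (inj₁ _) refl = ≢-sym (i≢fi (h p))
    proper (inj₂ _) (inj₂ _) ()

  -- Neighbours are counted separately in the clique and among the pendants.
  degree-vertex : ∀ s → degree (vertex s) ≡
    ∣ tabulate (λ j → does (adjacent? s (inj₁ j))) ∣ +
    ∣ tabulate (λ q → does (adjacent? s (inj₂ q))) ∣
  degree-vertex s = begin
    degree (vertex s)
      ≡⟨ cong (λ t → ∣ tabulate (λ w → does (adjacent? t (splitAt b w))) ∣) (split-vertex s) ⟩
    ∣ tabulate (λ w → does (adjacent? s (splitAt b w))) ∣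
      ≡⟨ ∣tabulate∣-+ b (λ w → does (adjacent? s (splitAt b w))) ⟩
    _ ≡⟨ cong₂ _+_
           (∣tabulate∣-cong (λ j → cong (does ∘ adjacent? s) (splitAt-↑ˡ b j n)))
           (∣tabulate∣-cong (λ q → cong (does ∘ adjacent? s) (splitAt-↑ʳ b n q))) ⟩
    _ ∎
    where open ≡-Reasoning

  degree-core : ∀ i → degree (core i) ≡ (b ∸ 1) + ∣ tabulate (λ q → does (i ≟ h q)) ∣
  degree-core i = trans (degree-vertex (inj₁ i))
    (cong (_+ ∣ tabulate (λ q → does (i ≟ h q)) ∣) (∣tabulate-≢∣ i))

  degree-pendant : ∀ p → degree (pendant p) ≡ 1
  degree-pendant p =
    trans (degree-vertex (inj₂ p)) (cong₂ _+_ (∣tabulate-≟∣ (h p)) (∣tabulate-false∣ n))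

-- The choice of attachment and the three invariants

module Construction (k d e : ℕ) where

  -- The parameters are the gaps in `2 ≤ a ≤ b ≤ c`. Of the `n` pendants, the first `e` are extra
  -- ones at clique vertex `zero`, and the other `a` go one to each of the first `a` clique
  -- vertices.
  a b c n : ℕ
  a = 2 + k
  b = a + d
  c = b + e
  n = e + a

  anchor : Fin n → Fin a
  anchor = [ const zero , id ]′ ∘ splitAt e

  anchor-extra : ∀ x → anchor (x ↑ˡ a) ≡ zero
  anchor-extra x = cong [ const zero , id ]′ (splitAt-↑ˡ e x a)

  anchor-own : ∀ i → anchor (e ↑ʳ i) ≡ i
  anchor-own i = cong [ const zero , id ]′ (splitAt-↑ʳ e a i)

  h : Fin n → Fin b
  h p = anchor p ↑ˡ d

  open PendantClique h
  open Graph graph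

  -- This serves as a colouring of the clique with `a` colours: it is injective on the vertices
  -- carrying pendants, and the remaining `d` vertices share the default colour `zero`.
  retract : Fin b → Fin a
  retract = [ id , const zero ]′ ∘ splitAt a

  retract-h : ∀ p → retract (h p) ≡ anchor p
  retract-h p = cong [ id , const zero ]′ (splitAt-↑ˡ a (anchor p) d)

  spvc : Spvc graph a
  spvc = (retract ∘ root , root-stronglyProper retract separated) , minimal
    where
    separated : ∀ p q → h p ≢ h q → retract (h p) ≢ retract (h q)
    separated p q hp≢hq eq =
      hp≢hq (cong (_↑ˡ d) (trans (sym (retract-h p)) (trans eq (retract-h q))))

    minimal : ∀ m → (Σ[ κ ∈ Colouring m ] StrongProperVertexConnected κ) → a ≤ m
    -- One pendant `e ↑ʳ i` is chosen per anchor; any two of them force their clique vertices to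
    -- differ in colour.
    minimal m (κ , strong) = injective⇒≤ {f = λ i → κ (core (h (e ↑ʳ i)))} injective
      where
      injective : ∀ {i j} → κ (core (h (e ↑ʳ i))) ≡ κ (core (h (e ↑ʳ j))) → i ≡ j
      injective {i} {j} eq with h (e ↑ʳ i) ≟ h (e ↑ʳ j)
      ... | yes hi≡hj = trans (sym (anchor-own i))
                          (trans (↑ˡ-injective d _ _ hi≡hj) (anchor-own j))
      ... | no  hi≢hj = ⊥-elim (stronglyProper-separates κ strong hi≢hj eq)

  chromatic : ChromaticNumber graph b
  -- `punchIn i zero` is a colour other than `i`; it exists because `b` is at least two.
  chromatic = properColouring (λ i → punchIn i zero) (λ i → ≢-sym (punchInᵢ≢i i zero)) ,
              λ { m (κ , proper) → proper⇒≤ κ proper }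

  pendantsAt : ∀ i → ∣ tabulate (λ q → does (i ≟ h q)) ∣ ≡
    ∣ tabulate {n = e} (λ _ → does (i ≟ zero)) ∣ + ∣ tabulate (λ j → does (i ≟ (j ↑ˡ d))) ∣
  pendantsAt i = trans (∣tabulate∣-+ e (λ q → does (i ≟ h q)))
    (cong₂ _+_
      (∣tabulate∣-cong (λ x → cong (λ j → does (i ≟ (j ↑ˡ d))) (anchor-extra x)))
      (∣tabulate∣-cong (λ j → cong (λ j → does (i ≟ (j ↑ˡ d))) (anchor-own j))))

  pendantsAt-≤ : ∀ i → ∣ tabulate (λ q → does (i ≟ h q)) ∣ ≤ e + 1
  pendantsAt-≤ i = begin
    ∣ tabulate (λ q → does (i ≟ h q)) ∣ ≡⟨ pendantsAt i ⟩
    ∣ tabulate {n = e} (λ _ → does (i ≟ zero)) ∣ + own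
      ≤⟨ +-mono-≤ (∣p∣≤n (tabulate {n = e} (λ _ → does (i ≟ zero)))) own≤1 ⟩
    e + 1 ∎
    where
    open ≤-Reasoning

    own = ∣ tabulate (λ j → does (i ≟ (j ↑ˡ d))) ∣

    own≤1 : own ≤ 1
    -- `own` counts the part of the singleton of `i` lying among the first `a` elements of
    -- `Fin (a + d)`.
    own≤1 = subst (own ≤_)
      (trans (sym (∣tabulate∣-+ a (λ j → does (i ≟ j)))) (∣tabulate-≟∣ i)) (m≤m+n own _)

  pendantsAt-zero : e + 1 ≤ ∣ tabulate (λ q → does (zero ≟ h q)) ∣
  pendantsAt-zero = begin
    -- At `zero` all `e` extra pendants count, and the first own pendant supplies the `1`.
    e + 1 ≤⟨ +-mono-≤ (≤-reflexive (sym (∣tabulate-true∣ e))) (s≤s z≤n) ⟩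
    _     ≡⟨ pendantsAt zero ⟨
    _     ∎
    where open ≤-Reasoning

  -- As `b` is a successor by definition, the extra `1` restores the one lost in `b ∸ 1`.
  clique+pendants : (b ∸ 1) + (e + 1) ≡ c
  clique+pendants = trans (cong ((b ∸ 1) +_) (+-comm e 1)) (+-suc (b ∸ 1) e)

  maximumDegree : MaximumDegree graph c
  maximumDegree = (core zero , degree-zero) , λ { m (v , refl) → ∀-vertex degree≤c v }
    where
    degree-zero : degree (core zero) ≡ c
    degree-zero = trans (degree-core zero)
      (trans (cong ((b ∸ 1) +_) (≤-antisym (pendantsAt-≤ zero) pendantsAt-zero)) clique+pendants)

    degree≤c : ∀ s → degree (vertex s) ≤ c
    degree≤c (inj₁ i) = begin
      degree (core i)                                 ≡⟨ degree-core i ⟩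
      (b ∸ 1) + ∣ tabulate (λ q → does (i ≟ h q)) ∣   ≤⟨ +-monoʳ-≤ (b ∸ 1) (pendantsAt-≤ i) ⟩
      (b ∸ 1) + (e + 1)                               ≡⟨ clique+pendants ⟩
      c                                               ∎
      where open ≤-Reasoning
    -- A pendant has degree one, and `c` is a successor.
    degree≤c (inj₂ p) = subst (_≤ c) (sym (degree-pendant p)) (s≤s z≤n)

theorem9 : (a b c : ℕ) → 2 ≤ a → a ≤ b → b ≤ c →
    Σ[ G ∈ Graph ] (Graph.Connected G × Spvc G a × ChromaticNumber G b × MaximumDegree G c)
theorem9 a b c 2≤a a≤b b≤c
  -- Each inequality yields its gap, and matching on `refl` rewrites `a`, `b` and `c` into the sums
  -- used by `Construction`.
  with k , refl ← m≤n⇒∃[o]m+o≡n 2≤a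
  with d , refl ← m≤n⇒∃[o]m+o≡n a≤b
  with e , refl ← m≤n⇒∃[o]m+o≡n b≤c
  = PendantClique.graph h , PendantClique.connected h , spvc , chromatic , maximumDegree
  where open Construction k d e
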